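{- Let $p\ge2$ be an integer and let $R=(R[0],\dots,R[p-1])$ be a $p$-fibred rational function with domain $A$, $\mathbb{Z}_p\subseteq A\subseteq\mathbb{Q}_p$, that is closed and avoiding. Assume that $R[r](\mathbb{Z}_p)\subseteq\mathbb{Z}_p$ for every $r\in\{0,\dots,p-1\}$ and that the $p$-fibred function $F:=(R[0]|_{\mathbb{Z}_p},\dots,R[p-1]|_{\mathbb{Z}_p})$, with entries regarded as functions $\mathbb{Z}_p\to\mathbb{Z}_p$, is a $p$-adic system in weak canonical form. Let $D$ be a finite sequence of length at least $1$ with entries in $\{0,\dots,p-1\}$. Then the function $R_D:A\to\mathbb{Q}_p$ has a unique fixed point in $\mathbb{Z}_p$.
   Context: $p\ge2$ is an integer, not necessarily prime. $\mathbb{Z}_p=\varprojlim \mathbb{Z}/p^k\mathbb{Z}$; every $a\in\mathbb{Z}_p$ is uniquely $a=\sum_{i\ge0}a_ip^i$ with $a_i\in\{0,\dots,p-1\}$, and $a\,\%\,p:=a_0$. $\mathbb{Q}_p=\mathbb{Z}_p[1/p]$. A $p$-fibred function with domain $\mathbb{Z}_p$ is a $p$-tuple $F=(F[0],\dots,F[p-1])$ of functions $F[r]:\mathbb{Z}_p\to\mathbb{Z}_p$, regarded also as a function $F:\mathbb{Z}_p\to\mathbb{Z}_p$ by $F(n)=\dfrac{F[n\%p](n)-(F[n\%p](n)\,\%\,p)}{p}$. The $F$-digit expansion of $n$ is $(F^k(n)\,\%\,p)_{k\ge0}$. $F$ is a $p$-adic system if for all integers $k\ge0$ and all $m,n\in\mathbb{Z}_p$: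 $m\equiv n\pmod{p^k}$ if and only if the first $k$ entries of the $F$-digit expansions of $m$ and $n$ coincide. $F$ is in weak canonical form if $F[r](r+p\mathbb{Z}_p)\subseteq p\mathbb{Z}_p$ for all $r\in\{0,\dots,p-1\}$. A $p$-fibred rational function with domain $A\subseteq\mathbb{Q}_p$ is a $p$-tuple $R=(R[0],\dots,R[p-1])$ of functions $R[r]:A\to\mathbb{Q}_p$. It is closed if $R[r](x)/p\in A$ for all $r\in\{0,\dots,p-1\}$ and $x\in A$. It is avoiding if for every $r\in\{0,\dots,p-1\}$: $R[r]\big((\mathbb{Q}_p\setminus(r+p\mathbb{Z}_p))\cap A\big)\cap p\mathbb{Z}_p=\emptyset$. For closed $R$ and a finite sequence $D=(d_0,\dots,d_{k-1})$ with entries in $\{0,\dots,p-1\}$, the function $R_D:A\to\mathbb{Q}_p$ is defined recursively by $R_{()}(x)=x$ and $R_{(d_0,\dots,d_{k-1})}(x)=R[d_{k-1}]\big(R_{(d_0,\dots,d_{k-2})}(x)\big)/p$ for $k\ge1$. -}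

module Defs where

open import Algebra.Bundles using (CommutativeRing)
open import Data.Fin.Base using (Fin; toℕ; fromℕ<)
open import Data.Integer.Base as ℤ using (ℤ; +_)
import Data.Integer.Properties as ℤ
open import Data.Integer.DivMod using (_%ℕ_; _/ℕ_; n%ℕd<d; a≡a%ℕn+[a/ℕn]*n)
import Data.Integer.Divisibility.Signed as ℤ
open import Data.Integer.Tactic.RingSolver using (solve-∀)
open import Data.Nat.Base as ℕ using (ℕ; zero; suc; _<_; NonZero; NonTrivial; nonTrivial⇒nonZero)
open import Data.Nat.GeneralisedArithmetic using (iterate)
open import Data.Fin.Properties using (toℕ-fromℕ<)
open import Data.Product.Base using (Σ; ∃; _×_; _,_; proj₁; proj₂)
open import Data.Vec.Functional using (Vector; init; last)
open import Function.Bundles using (Func; _⟨$⟩_; _⇔_)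
import Function.Construct.Composition as Composition
import Function.Construct.Identity as Identity
open import Level using (Level; 0ℓ) renaming (suc to lsuc)
open import Relation.Binary.Bundles using (Setoid)
open import Relation.Binary.Core using (Rel)
open import Relation.Binary.Definitions using (_Respects_)
open import Relation.Binary.PropositionalEquality as ≡ using (_≡_)
open import Relation.Nullary using (¬_)
open import Relation.Unary using (Pred)
import Algebra.Properties.Semiring.Divisibility
import Algebra.Properties.CommutativeSemiring.Exp
import Relation.Binary.Construct.On as On
import Relation.Binary.Reasoning.Setoid

-- Elements of ℤ/dℤ are represented by integers up to this relation.
infix 4 _≡_[mod_]
record _≡_[mod_] (a b d : ℤ) : Set where
  constructor mod
  field
    divisible : d ℤ.∣ a ℤ.- b

module _ {d : ℤ} where
  ≡mod-reflexive : ∀ {a b} → a ≡ b → a ≡ b [mod d ]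
  ≡mod-reflexive {a} ≡.refl = mod (ℤ.divides (+ 0) (ℤ.+-inverseʳ a))

  ≡mod-sym : ∀ {a b} → a ≡ b [mod d ] → b ≡ a [mod d ]
  ≡mod-sym {a} {b} (mod h) = mod (≡.subst (d ℤ.∣_) (eq a b) (ℤ.∣m⇒∣-m h))
    where
    eq : ∀ a b → ℤ.- (a ℤ.- b) ≡ b ℤ.- a
    eq = solve-∀

  ≡mod-trans : ∀ {a b c} → a ≡ b [mod d ] → b ≡ c [mod d ] → a ≡ c [mod d ]
  ≡mod-trans {a} {b} {c} (mod h) (mod k) =
    mod (≡.subst (d ℤ.∣_) (eq a b c) (ℤ.∣m∣n⇒∣m+n h k))
    where
    eq : ∀ a b c → (a ℤ.- b) ℤ.+ (b ℤ.- c) ≡ a ℤ.- c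
    eq = solve-∀

  +-cong-mod : ∀ {a b a′ b′} → a ≡ b [mod d ] → a′ ≡ b′ [mod d ] → a ℤ.+ a′ ≡ b ℤ.+ b′ [mod d ]
  +-cong-mod {a} {b} {a′} {b′} (mod h) (mod k) =
    mod (≡.subst (d ℤ.∣_) (eq a b a′ b′) (ℤ.∣m∣n⇒∣m+n h k))
    where
    eq : ∀ a b a′ b′ → (a ℤ.- b) ℤ.+ (a′ ℤ.- b′) ≡ (a ℤ.+ a′) ℤ.- (b ℤ.+ b′)
    eq = solve-∀

  neg-cong-mod : ∀ {a b} → a ≡ b [mod d ] → ℤ.- a ≡ ℤ.- b [mod d ]
  neg-cong-mod {a} {b} (mod h) = mod (≡.subst (d ℤ.∣_) (eq a b) (ℤ.∣m⇒∣-m h))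
    where
    eq : ∀ a b → ℤ.- (a ℤ.- b) ≡ (ℤ.- a) ℤ.- (ℤ.- b)
    eq = solve-∀

  *-cong-mod : ∀ {a b a′ b′} → a ≡ b [mod d ] → a′ ≡ b′ [mod d ] → a ℤ.* a′ ≡ b ℤ.* b′ [mod d ]
  *-cong-mod {a} {b} {a′} {b′} (mod h) (mod k) =
    mod (≡.subst (d ℤ.∣_) (eq a b a′ b′)
      (ℤ.∣m∣n⇒∣m+n (ℤ.∣m⇒∣m*n a′ h) (ℤ.∣n⇒∣m*n b k)))
    where
    eq : ∀ a b a′ b′ →
      (a ℤ.- b) ℤ.* a′ ℤ.+ b ℤ.* (a′ ℤ.- b′) ≡ a ℤ.* a′ ℤ.- b ℤ.* b′
    eq = solve-∀

-- If q x ≡ q y (mod q d) with q ≠ 0, then x ≡ y (mod d).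
mod-cancel : ∀ q .{{_ : ℤ.NonZero q}} d x y →
  q ℤ.* x ≡ q ℤ.* y [mod q ℤ.* d ] → x ≡ y [mod d ]
mod-cancel q d x y (mod h) =
  mod (ℤ.*-cancelˡ-∣ q (≡.subst (q ℤ.* d ℤ.∣_) (eq q x y) h))
  where
  eq : ∀ q a b → q ℤ.* a ℤ.- q ℤ.* b ≡ q ℤ.* (a ℤ.- b)
  eq = solve-∀

module Padic (p : ℕ) .{{_ : NonTrivial p}} where

  private instance
    p≢0 : NonZero p
    p≢0 = nonTrivial⇒nonZero p

  -- The inverse limit of the ℤ/pᵏℤ: the integer proj k represents the
  -- component in ℤ/pᵏℤ, so only its residue mod pᵏ matters (see _≈ₚ_).
  record ℤₚ : Set where
    no-eta-equality
    field
      proj     : ℕ → ℤ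
      coherent : ∀ k → proj (suc k) ≡ proj k [mod (+ p) ℤ.^ k ]
  open ℤₚ public

  infix 4 _≈ₚ_
  record _≈ₚ_ (x y : ℤₚ) : Set where
    no-eta-equality
    constructor mk≈
    field
      at : ∀ k → proj x k ≡ proj y k [mod (+ p) ℤ.^ k ]
  open _≈ₚ_ public

  fromℤ : ℤ → ℤₚ
  proj     (fromℤ a) _ = a
  coherent (fromℤ a) _ = ≡mod-reflexive ≡.refl

  infixl 6 _+ₚ_
  _+ₚ_ : ℤₚ → ℤₚ → ℤₚ
  proj     (x +ₚ y) k = proj x k ℤ.+ proj y k
  coherent (x +ₚ y) k = +-cong-mod (coherent x k) (coherent y k)

  infixl 7 _*ₚ_
  _*ₚ_ : ℤₚ → ℤₚ → ℤₚ
  proj     (x *ₚ y) k = proj x k ℤ.* proj y k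
  coherent (x *ₚ y) k = *-cong-mod (coherent x k) (coherent y k)

  infix 8 -ₚ_
  -ₚ_ : ℤₚ → ℤₚ
  proj     (-ₚ x) k = ℤ.- proj x k
  coherent (-ₚ x) k = neg-cong-mod (coherent x k)

  private
    pointwise : ∀ {x y} → (∀ k → proj x k ≡ proj y k) → x ≈ₚ y
    pointwise h = mk≈ λ k → ≡mod-reflexive (h k)

  ℤₚ-commutativeRing : CommutativeRing 0ℓ 0ℓ
  ℤₚ-commutativeRing = record
    { Carrier = ℤₚ
    ; _≈_ = _≈ₚ_
    ; _+_ = _+ₚ_
    ; _*_ = _*ₚ_
    ; -_  = -ₚ_
    ; 0#  = fromℤ (+ 0)
    ; 1#  = fromℤ (+ 1)
    ; isCommutativeRing = record
      { isRing = record
        { +-isAbelianGroup = record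
          { isGroup = record
            { isMonoid = record
              { isSemigroup = record
                { isMagma = record
                  { isEquivalence = record
                    { refl  = pointwise λ _ → ≡.refl
                    ; sym   = λ h → mk≈ λ k → ≡mod-sym (at h k)
                    ; trans = λ h h′ → mk≈ λ k → ≡mod-trans (at h k) (at h′ k)
                    }
                  ; ∙-cong = λ h h′ → mk≈ λ k → +-cong-mod (at h k) (at h′ k)
                  }
                ; assoc = λ x y z → pointwise λ k → ℤ.+-assoc (proj x k) (proj y k) (proj z k)
                }
              ; identity = (λ x → pointwise λ k → ℤ.+-identityˡ (proj x k))
                         , (λ x → pointwise λ k → ℤ.+-identityʳ (proj x k))
              }
            ; inverse = (λ x → pointwise λ k → ℤ.+-inverseˡ (proj x k))
                      , (λ x → pointwise λ k → ℤ.+-inverseʳ (proj x k))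
            ; ⁻¹-cong = λ h → mk≈ λ k → neg-cong-mod (at h k)
            }
          ; comm = λ x y → pointwise λ k → ℤ.+-comm (proj x k) (proj y k)
          }
        ; *-cong = λ h h′ → mk≈ λ k → *-cong-mod (at h k) (at h′ k)
        ; *-assoc = λ x y z → pointwise λ k → ℤ.*-assoc (proj x k) (proj y k) (proj z k)
        ; *-identity = (λ x → pointwise λ k → ℤ.*-identityˡ (proj x k))
                     , (λ x → pointwise λ k → ℤ.*-identityʳ (proj x k))
        ; distrib = (λ x y z → pointwise λ k → ℤ.*-distribˡ-+ (proj x k) (proj y k) (proj z k))
                  , (λ x y z → pointwise λ k → ℤ.*-distribʳ-+ (proj x k) (proj y k) (proj z k))
        }
      ; *-comm = λ x y → pointwise λ k → ℤ.*-comm (proj x k) (proj y k)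
      }
    }

  open CommutativeRing ℤₚ-commutativeRing
    using (_+_; _*_; _-_; setoid; semiring; commutativeSemiring
          ; refl; sym; trans; *-congˡ; *-congʳ; *-comm; *-assoc; *-identityʳ)
  open Algebra.Properties.Semiring.Divisibility semiring using (_∣_) renaming (_,_ to _∣,_)
  open Algebra.Properties.CommutativeSemiring.Exp commutativeSemiring using (_^_)

  ℤₚ-setoid : Setoid 0ℓ 0ℓ
  ℤₚ-setoid = setoid

  P : ℤₚ
  P = fromℤ (+ p)

  *P-cancel : ∀ {x y} → x * P ≈ₚ y * P → x ≈ₚ y
  *P-cancel {x} {y} h = mk≈ λ k →
    ≡mod-trans (≡mod-sym (coherent x k)) (≡mod-trans (cancelled k) (coherent y k))
    where
    cancelled : ∀ k → proj x (suc k) ≡ proj y (suc k) [mod (+ p) ℤ.^ k ]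
    cancelled k = mod-cancel (+ p) ((+ p) ℤ.^ k) (proj x (suc k)) (proj y (suc k))
      (≡.subst₂ (λ a b → a ≡ b [mod (+ p) ℤ.^ suc k ])
        (ℤ.*-comm (proj x (suc k)) (+ p)) (ℤ.*-comm (proj y (suc k)) (+ p)) (at h (suc k)))

  *P^-cancel : ∀ n {x y} → x * P ^ n ≈ₚ y * P ^ n → x ≈ₚ y
  *P^-cancel zero    {x} {y} h = trans (sym (*-identityʳ x)) (trans h (*-identityʳ y))
  *P^-cancel (suc n) {x} {y} h = *P-cancel (*P^-cancel n
    (trans (*-assoc x P (P ^ n)) (trans h (sym (*-assoc y P (P ^ n))))))

  -- The digit a₀ of a = Σ aᵢ pⁱ, which depends on a mod p only.
  infixl 7 _%p
  _%p : ℤₚ → Fin p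
  x %p = fromℕ< (n%ℕd<d (proj x 1) p)

  digit : Fin p → ℤₚ
  digit r = fromℤ (+ toℕ r)

  P∣x-x%p : ∀ x → P ∣ x - digit (x %p)
  P∣x-x%p x = quotient ∣, mk≈ λ k →
      ≡.subst (_≡ proj x k ℤ.- r [mod (+ p) ℤ.^ k ]) (ℤ._∣_.equality (p∣ k))
        (+-cong-mod (coherent x k) (≡mod-reflexive {a = ℤ.- r} ≡.refl))
    where
    r : ℤ
    r = + toℕ (x %p)

    proj≡r : ∀ k → proj x (suc k) ≡ r [mod + p ]
    proj≡r zero    = mod (ℤ.divides (proj x 1 /ℕ p)
      (≡.trans (≡.cong₂ ℤ._-_ (a≡a%ℕn+[a/ℕn]*n (proj x 1) p)
                               (≡.cong +_ (toℕ-fromℕ< (n%ℕd<d (proj x 1) p))))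
               (eq (+ (proj x 1 %ℕ p)) ((proj x 1 /ℕ p) ℤ.* + p))))
      where
      eq : ∀ a b → (a ℤ.+ b) ℤ.- a ≡ b
      eq = solve-∀
    proj≡r (suc k) = ≡mod-trans
      (mod (ℤ.∣-trans (ℤ.∣m⇒∣m*n ((+ p) ℤ.^ k) ℤ.∣-refl) (_≡_[mod_].divisible (coherent x (suc k)))))
      (proj≡r k)

    p∣ : ∀ k → + p ℤ.∣ proj x (suc k) ℤ.- r
    p∣ k = _≡_[mod_].divisible (proj≡r k)

    q : ℕ → ℤ
    q k = ℤ.quotient (p∣ k)

    p*q : ∀ k → proj x (suc k) ℤ.- r ≡ + p ℤ.* q k
    p*q k = ≡.trans (ℤ._∣_.equality (p∣ k)) (ℤ.*-comm (q k) (+ p))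

    q-coherent : ∀ k → q (suc k) ≡ q k [mod (+ p) ℤ.^ k ]
    q-coherent k = mod-cancel (+ p) ((+ p) ℤ.^ k) (q (suc k)) (q k)
      (≡.subst₂ (λ a b → a ≡ b [mod (+ p) ℤ.^ suc k ]) (p*q (suc k)) (p*q k)
        (+-cong-mod (coherent x (suc k)) (≡mod-reflexive {a = ℤ.- r} ≡.refl)))

    quotient : ℤₚ
    proj     quotient = q
    coherent quotient = q-coherent

  -- (x − x % p) / p; the quotient is unique by *P-cancel.
  quot : ℤₚ → ℤₚ
  quot x = let (q ∣, _) = P∣x-x%p x in q

  pℤₚ : Pred ℤₚ 0ℓ
  pℤₚ x = P ∣ x

  infixl 6 _+pℤₚ
  _+pℤₚ : Fin p → Pred ℤₚ 0ℓ
  (r +pℤₚ) x = P ∣ x - digit r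

  infix 4 _≡ₚ_[modp^_]
  _≡ₚ_[modp^_] : ℤₚ → ℤₚ → ℕ → Set
  m ≡ₚ n [modp^ k ] = P ^ k ∣ m - n

  -- ℤₚ[1/p]: num /p^ exp stands for the fraction num / p ^ exp.
  infix 5 _/p^_
  record ℚₚ : Set where
    constructor _/p^_
    field
      num : ℤₚ
      exp : ℕ
  open ℚₚ public

  -- Equality of fractions; no extra power of p is needed, since p is
  -- not a zero divisor in ℤₚ (*P-cancel).
  infix 4 _≈ℚ_
  record _≈ℚ_ (x y : ℚₚ) : Set where
    constructor mk≈ℚ
    field
      cross : num x * P ^ exp y ≈ₚ num y * P ^ exp x
  open _≈ℚ_ public

  ℚₚ-setoid : Setoid 0ℓ 0ℓ
  ℚₚ-setoid = record
    { Carrier = ℚₚ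
    ; _≈_ = _≈ℚ_
    ; isEquivalence = record
      { refl  = mk≈ℚ refl
      ; sym   = λ h → mk≈ℚ (sym (cross h))
      ; trans = λ {x} {y} {z} → ≈ℚ-trans x y z
      }
    }
    where
    swap : ∀ a b c → a * b * c ≈ₚ a * c * b
    swap a b c = trans (*-assoc a b c) (trans (*-congˡ (*-comm b c)) (sym (*-assoc a c b)))

    ≈ℚ-trans : ∀ x y z → x ≈ℚ y → y ≈ℚ z → x ≈ℚ z
    ≈ℚ-trans (a /p^ k) (b /p^ l) (c /p^ m) (mk≈ℚ h) (mk≈ℚ h′) = mk≈ℚ (*P^-cancel l (begin
      a * P ^ m * P ^ l ≈⟨ swap a (P ^ m) (P ^ l) ⟩
      a * P ^ l * P ^ m ≈⟨ *-congʳ h ⟩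
      b * P ^ k * P ^ m ≈⟨ swap b (P ^ k) (P ^ m) ⟩
      b * P ^ m * P ^ k ≈⟨ *-congʳ h′ ⟩
      c * P ^ l * P ^ k ≈⟨ swap c (P ^ l) (P ^ k) ⟩
      c * P ^ k * P ^ l ∎))
      where open Relation.Binary.Reasoning.Setoid setoid

  ι : ℤₚ → ℚₚ
  ι a = a /p^ 0

  ι-injective : ∀ {a b} → ι a ≈ℚ ι b → a ≈ₚ b
  ι-injective {a} {b} (mk≈ℚ h) = trans (sym (*-identityʳ a)) (trans h (*-identityʳ b))

  ι-cong : ∀ {a b} → a ≈ₚ b → ι a ≈ℚ ι b
  ι-cong h = mk≈ℚ (*-congʳ h)

  -- The image in ℚₚ of a subset of ℤₚ.
  ι[_] : Pred ℤₚ 0ℓ → Pred ℚₚ 0ℓ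
  ι[ S ] x = ∃ λ a → S a × x ≈ℚ ι a

  infixl 7 _/p
  _/p : ℚₚ → ℚₚ
  (a /p^ k) /p = a /p^ suc k

  /p-cong : ∀ {x y} → x ≈ℚ y → x /p ≈ℚ y /p
  /p-cong {a /p^ k} {b /p^ l} (mk≈ℚ h) = mk≈ℚ
    (trans (pull a l) (trans (*-congʳ h) (sym (pull b k))))
    where
    pull : ∀ a n → a * P ^ suc n ≈ₚ a * P ^ n * P
    pull a n = trans (*-congˡ (*-comm P (P ^ n))) (sym (*-assoc a (P ^ n) P))

  FibredFunction : Set
  FibredFunction = Vector (Func ℤₚ-setoid ℤₚ-setoid) p

  apply : FibredFunction → ℤₚ → ℤₚ
  apply F n = quot (F (n %p) ⟨$⟩ n)

  expansion : FibredFunction → ℤₚ → ℕ → Fin p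
  expansion F n k = iterate (apply F) n k %p

  IsPadicSystem : FibredFunction → Set
  IsPadicSystem F = ∀ k m n →
    m ≡ₚ n [modp^ k ] ⇔ (∀ i → i < k → expansion F m i ≡ expansion F n i)

  WeakCanonicalForm : FibredFunction → Set
  WeakCanonicalForm F = ∀ r n → (r +pℤₚ) n → pℤₚ (F r ⟨$⟩ n)

  record Subset (ℓ : Level) : Set (lsuc ℓ) where
    field
      member   : Pred ℚₚ ℓ
      respects : member Respects _≈ℚ_

  infix 4 _∈_
  _∈_ : ∀ {ℓ} → ℚₚ → Subset ℓ → Set ℓ
  x ∈ A = Subset.member A x

  -- A as a setoid: the membership proof is irrelevant to equality.
  ∣_∣ : ∀ {ℓ} → Subset ℓ → Setoid ℓ 0ℓ
  ∣ A ∣ = On.setoid {B = Σ ℚₚ (_∈ A)} ℚₚ-setoid proj₁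

  FibredRational : ∀ {ℓ} → Subset ℓ → Set ℓ
  FibredRational A = Vector (Func ∣ A ∣ ℚₚ-setoid) p

  Containsℤₚ : ∀ {ℓ} → Subset ℓ → Set ℓ
  Containsℤₚ A = ∀ a → ι a ∈ A

  module _ {ℓ} (A : Subset ℓ) (R : FibredRational A) where

    Closed : Set ℓ
    Closed = ∀ r x → (R r ⟨$⟩ x) /p ∈ A

    Avoiding : Set ℓ
    Avoiding = ∀ r (x : Setoid.Carrier ∣ A ∣) →
      ¬ ι[ r +pℤₚ ] (proj₁ x) → ¬ ι[ pℤₚ ] (R r ⟨$⟩ x)

    MapsℤₚToℤₚ : Containsℤₚ A → Set
    MapsℤₚToℤₚ ℤₚ⊆A = ∀ r a → ∃ λ b → R r ⟨$⟩ (ι a , ℤₚ⊆A a) ≈ℚ ι b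

    restriction : (ℤₚ⊆A : Containsℤₚ A) → MapsℤₚToℤₚ ℤₚ⊆A → FibredFunction
    restriction ℤₚ⊆A int r = record
      { to   = λ a → proj₁ (int r a)
      ; cong = λ {a} {b} a≈b → ι-injective
          (ℚ.trans (ℚ.sym (proj₂ (int r a)))
            (ℚ.trans (Func.cong (R r) (ι-cong a≈b)) (proj₂ (int r b))))
      }
      where module ℚ = Setoid ℚₚ-setoid

    module _ (closed : Closed) where

      step : Fin p → Func ∣ A ∣ ∣ A ∣
      step d = record
        { to   = λ x → (R d ⟨$⟩ x) /p , closed d x
        ; cong = λ x≈y → /p-cong (Func.cong (R d) x≈y)
        }

      -- R_D with its codomain cut down to A, as the recursion requires:
      -- D = (d₀,…,dₖ₋₁) is applied with d₀ first and dₖ₋₁ last.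
      compositionᴬ : ∀ {k} → Vector (Fin p) k → Func ∣ A ∣ ∣ A ∣
      compositionᴬ {zero}  D = Identity.function ∣ A ∣
      compositionᴬ {suc k} D = Composition.function (compositionᴬ (init D)) (step (last D))

      composition : ∀ {k} → Vector (Fin p) k → Func ∣ A ∣ ℚₚ-setoid
      composition D = Composition.function (compositionᴬ D) (record { to = proj₁ ; cong = λ x≈y → x≈y })

{-# OPTIONS --safe #-}

-- By avoidance and weak canonical form, x ∈ ℤₚ satisfies R_D(x) ∈ ℤₚ exactly
-- when the F-digit expansion of x starts with D, and then R_D(x) = F^|D|(x).
-- Hence the integral fixed points of R_D are the x whose F-digit expansion is
-- the periodic sequence D^∞.  An F-digit expansion determines its p-adic
-- integer, and every digit sequence is an F-digit expansion: if n has the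
-- right first k digits, then so have all n + j pᵏ, and as j runs through
-- {0,…,p−1} their next digits are distinct, so that one of them is right too.
module Submission where

open import Defs
open import Data.Nat.Base using (ℕ; suc; NonTrivial)
open import Data.Fin.Base using (Fin)
open import Data.Product using (_,_; ∃!)
open import Data.Vec.Functional using (Vector)
open import Function.Bundles using (_⟨$⟩_)
open import Level using (Level)

open import Algebra.Bundles using (CommutativeRing)
import Algebra.Properties.CommutativeSemiring.Exp
import Algebra.Properties.Semiring.Divisibility
import Algebra.Properties.CommutativeSemigroup
open import Data.Fin.Base using (toℕ; inject₁; fromℕ; punchOut)
open import Data.Fin.Properties
  using (_≟_; any?; injective⇒≤; punchOut-injective; toℕ-injective; toℕ<n
        ; toℕ-fromℕ<; fromℕ<-cong; toℕ-inject₁; toℕ-fromℕ)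
open import Data.Fin.Relation.Unary.Top using (View; view; ‵fromℕ; ‵inj₁)
open import Data.Integer.Base as ℤ using (ℤ; +_)
import Data.Integer.Divisibility.Signed as ℤ
import Data.Integer.Properties as ℤ
open import Data.Integer.Tactic.RingSolver using (solve-∀)
open import Data.Nat.Base as ℕ using (zero; _<_; NonZero; nonTrivial⇒nonZero)
import Data.Nat.Divisibility as ℕ
open import Data.Nat.DivMod
  using (_%_; _/_; m≡m%n+[m/n]*n; [m+n]%n≡m%n; m<n⇒m%n≡m; m%n<n)
  renaming (_mod_ to _modℕ_)
open import Data.Nat.GeneralisedArithmetic using (iterate)
import Data.Nat.Properties as ℕ
open import Data.Product using (∃; proj₁; proj₂)
open import Data.Sum using (_⊎_; inj₁; inj₂)
open import Data.Vec.Functional using (init; last)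
open import Function.Bundles using (Func; Equivalence)
open import Function.Definitions using (Injective)
open import Relation.Binary.Bundles using (Setoid)
open import Relation.Binary.PropositionalEquality as ≡ using (_≡_)
open import Relation.Nullary using (¬_; Dec; yes; no; contradiction)
open import Relation.Nullary.Decidable using (decidable-stable; map′)

-- Finite pigeonhole, iteration and integer congruences.

-- If `y` were missed, punching it out of the codomain would leave an injection from `Fin (suc n)`
-- into `Fin n`.
Fin-injective⇒surjective : ∀ {n} {f : Fin n → Fin n} →
  Injective _≡_ _≡_ f → ∀ y → ∃ λ x → f x ≡ y
Fin-injective⇒surjective {suc n} {f} inj y with any? (λ x → f x ≟ y)
... | yes hit = hit
... | no miss = contradiction (injective⇒≤ punched-injective) ℕ.1+n≰n
  where
  avoids : ∀ x → ¬ y ≡ f x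
  avoids x y≡fx = miss (x , ≡.sym y≡fx)

  punched-injective : Injective _≡_ _≡_ (λ x → punchOut (avoids x))
  punched-injective eq = inj (punchOut-injective (avoids _) (avoids _) eq)

module _ {a} {A : Set a} where

  iterate-+ : ∀ (f : A → A) x m n → iterate f x (m ℕ.+ n) ≡ iterate f (iterate f x m) n
  iterate-+ f x zero    n = ≡.refl
  iterate-+ f x (suc m) n = iterate-+ f (f x) m n

  iterate-suc : ∀ (f : A → A) x n → iterate f x (suc n) ≡ f (iterate f x n)
  iterate-suc f x zero    = ≡.refl
  iterate-suc f x (suc n) = iterate-suc f (f x) n

  periodic-% : ∀ (f : ℕ → A) n .{{_ : NonZero n}} →
    (∀ i → f (n ℕ.+ i) ≡ f i) → ∀ i → f i ≡ f (i % n)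
  periodic-% f n periodic i =
    ≡.trans (≡.cong f (≡.trans (m≡m%n+[m/n]*n i n) (ℕ.+-comm (i % n) (i / n ℕ.* n))))
      (shift (i / n))
    where
    shift : ∀ q → f (q ℕ.* n ℕ.+ i % n) ≡ f (i % n)
    shift zero    = ≡.refl
    shift (suc q) = ≡.trans (≡.cong f (ℕ.+-assoc n (q ℕ.* n) (i % n)))
      (≡.trans (periodic _) (shift q))

-- The distance between two naturals below `n` is itself below `n`, and the only multiple of `n`
-- that small is 0.
<⇒≡mod⇒≡ : ∀ {n a b} → a < n → b < n → + a ≡ + b [mod + n ] → a ≡ b
<⇒≡mod⇒≡ {n} {a} {b} a<n b<n (mod n∣a-b) = ℤ.+-injective (ℤ.i-j≡0⇒i≡j (+ a) (+ b)
  (≡.trans (ℤ.m-n≡m⊖n a b) (ℤ.∣i∣≡0⇒i≡0 (n∣m<n⇒m≡0 _ distance<n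
    (≡.subst (λ i → n ℕ.∣ ℤ.∣ i ∣) (ℤ.m-n≡m⊖n a b) (ℤ.∣⇒∣ᵤ n∣a-b))))))
  where
  distance<n : ℤ.∣ a ℤ.⊖ b ∣ < n
  distance<n = ℕ.≤-<-trans (ℤ.∣m⊝n∣≤m⊔n a b) (ℕ.⊔-lub a<n b<n)

  n∣m<n⇒m≡0 : ∀ m → m < n → n ℕ.∣ m → m ≡ 0
  n∣m<n⇒m≡0 zero    _   _   = ≡.refl
  n∣m<n⇒m≡0 (suc m) m<n n∣m = contradiction n∣m (ℕ.>⇒∤ m<n)

∣-resp-≡mod : ∀ {d a b} → a ≡ b [mod d ] → d ℤ.∣ a → d ℤ.∣ b
∣-resp-≡mod {d} {a} {b} (mod d∣a-b) d∣a =
  ≡.subst (d ℤ.∣_) (eq a b) (ℤ.∣m∣n⇒∣m-n d∣a d∣a-b)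
  where
  eq : ∀ a b → a ℤ.- (a ℤ.- b) ≡ b
  eq = solve-∀

≡mod-weaken : ∀ {d e a b} → d ℤ.∣ e → a ≡ b [mod e ] → a ≡ b [mod d ]
≡mod-weaken d∣e (mod e∣a-b) = mod (ℤ.∣-trans d∣e e∣a-b)

-- Divisibility and leading digits of p-adic integers.

module PadicProperties (p : ℕ) .{{_ : NonTrivial p}} where
  open Padic p
  open CommutativeRing ℤₚ-commutativeRing
    using ( _*_; _-_; 0#; semiring; commutativeSemiring; *-commutativeSemigroup
          ; refl; sym; trans; +-congʳ; *-congʳ; *-congˡ; *-assoc; *-identityʳ)
  open Algebra.Properties.Semiring.Divisibility semiring
    using (_∣_; ∣ʳ-respʳ-≈) renaming (_,_ to _∣,_)
  open Algebra.Properties.CommutativeSemiring.Exp commutativeSemiring using (_^_)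
  open Algebra.Properties.CommutativeSemigroup *-commutativeSemigroup
    using (x∙yz≈xz∙y; x∙yz≈xy∙z)
  private module ℚ = Setoid ℚₚ-setoid

  private instance
    p≢0 : NonZero p
    p≢0 = nonTrivial⇒nonZero p

    p^k≢0 : ∀ {k} → ℤ.NonZero ((+ p) ℤ.^ k)
    p^k≢0 {zero}  = _
    p^k≢0 {suc k} = ℤ.i*j≢0 (+ p) ((+ p) ℤ.^ k) {{p≢0}} {{p^k≢0 {k}}}

  proj-P^ : ∀ k j → proj (P ^ k) j ≡ (+ p) ℤ.^ k
  proj-P^ zero    j = ≡.refl
  proj-P^ (suc k) j = ≡.cong (+ p ℤ.*_) (proj-P^ k j)

  p∣p^1+k : ∀ k → + p ℤ.∣ (+ p) ℤ.^ suc k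
  p∣p^1+k k = ℤ.∣m⇒∣m*n ((+ p) ℤ.^ k) ℤ.∣-refl

  proj-1+k≡proj-1 : ∀ x k → proj x (suc k) ≡ proj x 1 [mod + p ]
  proj-1+k≡proj-1 x zero    = ≡mod-reflexive ≡.refl
  proj-1+k≡proj-1 x (suc k) =
    ≡mod-trans (≡mod-weaken (p∣p^1+k k) (coherent x (suc k))) (proj-1+k≡proj-1 x k)

  P^∣⇒p^∣proj : ∀ k {x} → P ^ k ∣ x → (+ p) ℤ.^ k ℤ.∣ proj x k
  P^∣⇒p^∣proj k (q ∣, eq) = ∣-resp-≡mod (at eq k)
    (ℤ.∣n⇒∣m*n (proj q k) (≡.subst ((+ p) ℤ.^ k ℤ.∣_) (≡.sym (proj-P^ k k)) ℤ.∣-refl))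

  P∣⇒p∣proj-1 : ∀ {x} → P ∣ x → + p ℤ.∣ proj x 1
  P∣⇒p∣proj-1 {x} (q ∣, eq) = ∣-resp-≡mod (≡mod-weaken (p∣p^1+k 0) (at eq 1))
    (ℤ.∣n⇒∣m*n (proj q 1) ℤ.∣-refl)

  proj-1≡%p : ∀ x → proj x 1 ≡ + toℕ (x %p) [mod + p ]
  proj-1≡%p x = mod (P∣⇒p∣proj-1 (P∣x-x%p x))

  %p-unique : ∀ x {n} → n < p → proj x 1 ≡ + n [mod + p ] → toℕ (x %p) ≡ n
  %p-unique x n<p x≡n = <⇒≡mod⇒≡ (toℕ<n (x %p)) n<p (≡mod-trans (≡mod-sym (proj-1≡%p x)) x≡n)

  +pℤₚ⇒%p : ∀ r x → (r +pℤₚ) x → x %p ≡ r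
  +pℤₚ⇒%p r x x∈ = toℕ-injective (%p-unique x (toℕ<n r) (mod (P∣⇒p∣proj-1 x∈)))

  x-0≈x : ∀ x → x - 0# ≈ₚ x
  x-0≈x x = mk≈ λ k → ≡mod-reflexive (ℤ.+-identityʳ (proj x k))

  p∣proj-1⇒%p≡0 : ∀ x → + p ℤ.∣ proj x 1 → toℕ (x %p) ≡ 0
  p∣proj-1⇒%p≡0 x p∣ = %p-unique x (ℕ.>-nonZero⁻¹ p)
    (mod (≡.subst (+ p ℤ.∣_) (≡.sym (ℤ.+-identityʳ (proj x 1))) p∣))

  P∣⇒%p≡0 : ∀ x → P ∣ x → toℕ (x %p) ≡ 0
  P∣⇒%p≡0 x P∣x = p∣proj-1⇒%p≡0 x (P∣⇒p∣proj-1 P∣x)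

  %p≡0⇒quot*P≈ : ∀ x → toℕ (x %p) ≡ 0 → quot x * P ≈ₚ x
  %p≡0⇒quot*P≈ x x%p≡0 = let (_ ∣, quot*P≈x-x%p) = P∣x-x%p x in trans quot*P≈x-x%p
    (trans (mk≈ λ k → ≡mod-reflexive (≡.cong (λ r → proj x k ℤ.- + r) x%p≡0)) (x-0≈x x))

  -- Reduces divisibility in the ring to a single integer component. The leading digit of `x` is 0,
  -- because all components from the first on agree mod `p`; hence `quot` divides exactly and the
  -- induction continues with the quotient.
  p^∣proj⇒P^∣ : ∀ k x → (+ p) ℤ.^ k ℤ.∣ proj x k → P ^ k ∣ x
  p^∣proj⇒P^∣ zero    x _  = x ∣, *-identityʳ x
  p^∣proj⇒P^∣ (suc k) x p^∣ = lift (p^∣proj⇒P^∣ k (quot x) p^∣quot)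
    where
    quot*P≈x : quot x * P ≈ₚ x
    quot*P≈x = %p≡0⇒quot*P≈ x (p∣proj-1⇒%p≡0 x
      (∣-resp-≡mod (proj-1+k≡proj-1 x k) (ℤ.∣-trans (p∣p^1+k k) p^∣)))

    p^∣quot : (+ p) ℤ.^ k ℤ.∣ proj (quot x) k
    -- Cancelling `p` costs one level: it informs about component `suc k` of the quotient, and
    -- coherence brings this down to component `k`.
    p^∣quot = ∣-resp-≡mod (coherent (quot x) k) (ℤ.*-cancelˡ-∣ (+ p)
      (≡.subst ((+ p) ℤ.^ suc k ℤ.∣_) (ℤ.*-comm (proj (quot x) (suc k)) (+ p))
        (∣-resp-≡mod (≡mod-sym (at quot*P≈x (suc k))) p^∣)))

    lift : P ^ k ∣ quot x → P ^ suc k ∣ x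
    lift (q ∣, eq) = q ∣, trans (x∙yz≈xz∙y q P (P ^ k)) (trans (*-congʳ eq) quot*P≈x)

  -- Integral fractions and their decidability.

  /p≈ι : ∀ {a b} → a ≈ₚ b * P → (ι a) /p ≈ℚ ι b
  /p≈ι {a} {b} a≈ = mk≈ℚ (trans (*-identityʳ a) (trans a≈ (*-congˡ (sym (*-identityʳ P)))))

  /p≈ι⁻¹ : ∀ x {b} → x /p ≈ℚ ι b → x ≈ℚ ι (b * P)
  /p≈ι⁻¹ (a /p^ k) {b} (mk≈ℚ eq) = mk≈ℚ (trans eq (x∙yz≈xy∙z b P (P ^ k)))

  p∣num⇒≈quot/p^ : ∀ a k → toℕ (a %p) ≡ 0 → a /p^ suc k ≈ℚ quot a /p^ k
  p∣num⇒≈quot/p^ a k a%p≡0 =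
    mk≈ℚ (trans (*-congʳ (sym (%p≡0⇒quot*P≈ a a%p≡0))) (*-assoc (quot a) P (P ^ k)))

  -- A fraction with denominator `p ^ suc k` is integral only if the leading digit of its numerator
  -- is 0, and then one factor `p` cancels.
  integral? : ∀ a k → Dec (∃ λ b → a /p^ k ≈ℚ ι b)
  integral? a zero    = yes (a , ℚ.refl)
  integral? a (suc k) with toℕ (a %p) ℕ.≟ 0
  ... | no a%p≢0 = no λ { (b , mk≈ℚ eq) → a%p≢0 (P∣⇒%p≡0 a
          (b * P ^ k ∣, trans (sym (x∙yz≈xz∙y b P (P ^ k))) (trans (sym eq) (*-identityʳ a)))) }
  ... | yes a%p≡0 = map′
    (λ { (b , eq) → b , ℚ.trans (p∣num⇒≈quot/p^ a k a%p≡0) eq })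
    (λ { (b , eq) → b , ℚ.trans (ℚ.sym (p∣num⇒≈quot/p^ a k a%p≡0)) eq })
    (integral? (quot a) k)

  +pℤₚ-resp-≈ : ∀ r {x y} → x ≈ₚ y → (r +pℤₚ) x → (r +pℤₚ) y
  +pℤₚ-resp-≈ r x≈y = ∣ʳ-respʳ-≈ (+-congʳ x≈y)

  -- Needed to contrapose `Avoiding`, whose premise is a negated membership. An integral
  -- representative is unique up to `≈ₚ`, so testing the digit of one suffices.
  ι[+pℤₚ]? : ∀ r x → Dec (ι[ r +pℤₚ ] x)
  ι[+pℤₚ]? r x with integral? (num x) (exp x)
  ... | no ¬int = no λ { (a , _ , eq) → ¬int (a , eq) }
  ... | yes (a , eq) with a %p ≟ r
  ...   | yes ≡.refl = yes (a , P∣x-x%p a , eq)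
  ...   | no a%p≢r   = no λ { (b , b∈ , eq′) →
            a%p≢r (+pℤₚ⇒%p r a (+pℤₚ-resp-≈ r (ι-injective (ℚ.trans (ℚ.sym eq′) eq)) b∈)) }

  -- Existence and uniqueness of elements with a given digit expansion.

  module PadicSystem (F : FibredFunction) (padic : IsPadicSystem F) where

    -- Together with its converse below, this restates `IsPadicSystem` through single components, so
    -- that approximating integers can be compared directly.
    ≡mod⇒expansion≡ : ∀ k x y → proj x k ≡ proj y k [mod (+ p) ℤ.^ k ] →
      ∀ {i} → i < k → expansion F x i ≡ expansion F y i
    ≡mod⇒expansion≡ k x y (mod p^∣) {i} =
      Equivalence.to (padic k x y) (p^∣proj⇒P^∣ k (x - y) p^∣) i

    expansion≡⇒≡mod : ∀ k x y → (∀ i → i < k → expansion F x i ≡ expansion F y i) →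
      proj x k ≡ proj y k [mod (+ p) ℤ.^ k ]
    expansion≡⇒≡mod k x y h = mod (P^∣⇒p^∣proj k (Equivalence.from (padic k x y) h))

    -- Comes from the system property at `suc i`, which covers entry `i`; no congruence of `quot` or
    -- `_%p` has to be established.
    expansion-cong : ∀ {x y} → x ≈ₚ y → ∀ i → expansion F x i ≡ expansion F y i
    expansion-cong {x} {y} x≈y i = ≡mod⇒expansion≡ (suc i) x y (at x≈y (suc i)) (ℕ.n<1+n i)

    expansion-injective : ∀ {x y} → (∀ i → expansion F x i ≡ expansion F y i) → x ≈ₚ y
    expansion-injective {x} {y} h = mk≈ λ k → expansion≡⇒≡mod k x y λ i _ → h i

    -- As `j` varies, these are the `p` lifts of the class of `a` mod p^k to classes mod p^(k+1).
    refine : ℤ → ℕ → Fin p → ℤ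
    refine a k j = a ℤ.+ (+ p) ℤ.^ k ℤ.* + toℕ j

    refine≡ : ∀ a k j → refine a k j ≡ a [mod (+ p) ℤ.^ k ]
    refine≡ a k j = mod (≡.subst ((+ p) ℤ.^ k ℤ.∣_) (eq a ((+ p) ℤ.^ k ℤ.* + toℕ j))
      (ℤ.∣m⇒∣m*n (+ toℕ j) ℤ.∣-refl))
      where
      eq : ∀ a b → b ≡ (a ℤ.+ b) ℤ.- a
      eq = solve-∀

    refine-injective : ∀ a k {i j} →
      refine a k i ≡ refine a k j [mod (+ p) ℤ.^ suc k ] → i ≡ j
    refine-injective a k {i} {j} (mod p^∣) = toℕ-injective (<⇒≡mod⇒≡ (toℕ<n i) (toℕ<n j)
      (mod-cancel p^k {{p^k≢0 {k}}} (+ p) (+ toℕ i) (+ toℕ j)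
        (mod (≡.subst₂ ℤ._∣_ (ℤ.*-comm (+ p) p^k) (eq a (p^k ℤ.* + toℕ i) (p^k ℤ.* + toℕ j)) p^∣))))
      where
      p^k = (+ p) ℤ.^ k

      eq : ∀ a b c → (a ℤ.+ b) ℤ.- (a ℤ.+ c) ≡ b ℤ.- c
      eq = solve-∀

    -- Two lifts agree in the entries before `k`, both being congruent to `a`. If entry `k` agrees
    -- as well, they are congruent mod p^(k+1), hence have the same `j`. So `j` determines the digit
    -- injectively, and therefore surjectively.
    refine-digit : ∀ a k r → ∃ λ j → expansion F (fromℤ (refine a k j)) k ≡ r
    refine-digit a k = Fin-injective⇒surjective λ {i} {j} eq →
      refine-injective a k (expansion≡⇒≡mod (suc k) (fromℤ (refine a k i)) (fromℤ (refine a k j))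
        λ l l<1+k → agree eq l (ℕ.m<1+n⇒m<n∨m≡n l<1+k))
      where
      agree : ∀ {i j} →
        expansion F (fromℤ (refine a k i)) k ≡ expansion F (fromℤ (refine a k j)) k →
        ∀ l → l < k ⊎ l ≡ k →
        expansion F (fromℤ (refine a k i)) l ≡ expansion F (fromℤ (refine a k j)) l
      agree {i} {j} eq l (inj₁ l<k)    = ≡mod⇒expansion≡ k _ _
        (≡mod-trans (refine≡ a k i) (≡mod-sym (refine≡ a k j))) l<k
      agree         eq l (inj₂ ≡.refl) = eq

    module _ (e : ℕ → Fin p) where

      approximant : ℕ → ℤ
      -- Any integer would serve here: modulo p^0 = 1 there is no digit to match.
      approximant zero    = + 0
      approximant (suc k) =
        refine (approximant k) k (proj₁ (refine-digit (approximant k) k (e k)))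

      limit : ℤₚ
      proj     limit   = approximant
      coherent limit k = refine≡ (approximant k) k _

      -- Entry `i` is settled at stage `suc i`, and component `suc i` of `limit` is exactly that
      -- approximant.
      expansion-limit : ∀ i → expansion F limit i ≡ e i
      expansion-limit i = ≡.trans
        (≡mod⇒expansion≡ (suc i) limit (fromℤ (approximant (suc i)))
          (≡mod-reflexive ≡.refl) (ℕ.n<1+n i))
        (proj₂ (refine-digit (approximant i) i (e i)))

  -- Compositions on integral arguments and their fixed points.

  module Fixed {ℓ} (A : Subset ℓ) (ℤₚ⊆A : Containsℤₚ A) (R : FibredRational A)
    (closed : Closed A R) (avoiding : Avoiding A R)
    (integral : MapsℤₚToℤₚ A R ℤₚ⊆A)
    (padic : IsPadicSystem (restriction A R ℤₚ⊆A integral))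
    (canonical : WeakCanonicalForm (restriction A R ℤₚ⊆A integral))
    where

    private
      F : FibredFunction
      F = restriction A R ℤₚ⊆A integral

      ιᴬ : ℤₚ → Setoid.Carrier ∣ A ∣
      ιᴬ x = ι x , ℤₚ⊆A x

    open PadicSystem F padic

    -- Weak canonical form makes the value of `F d` at `x` divisible by `P`, so `quot` subtracts the
    -- digit 0 and is true division by `p`.
    step-ι : ∀ d x → x %p ≡ d → proj₁ (step A R closed d ⟨$⟩ ιᴬ x) ≈ℚ ι (apply F x)
    step-ι d x ≡.refl = ℚ.trans (/p-cong (proj₂ (integral d x)))
      (/p≈ι (sym (%p≡0⇒quot*P≈ _ (P∣⇒%p≡0 _ (canonical d x (P∣x-x%p x))))))

    -- An integral result `b` means that `R d` takes the value `b * P` at `z`, which avoidance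
    -- forbids outside the class of `d`. Decidability removes the double negation.
    step-ι⁻¹ : ∀ d z {b} → proj₁ (step A R closed d ⟨$⟩ z) ≈ℚ ι b → ι[ d +pℤₚ ] (proj₁ z)
    step-ι⁻¹ d z {b} eq = decidable-stable (ι[+pℤₚ]? d (proj₁ z)) λ z∉ →
      avoiding d z z∉ (b * P , (b ∣, refl) , /p≈ι⁻¹ (R d ⟨$⟩ z) eq)

    composition-ι : ∀ {k} (D : Vector (Fin p) k) x →
      (∀ i → expansion F x (toℕ i) ≡ D i) →
      composition A R closed D ⟨$⟩ ιᴬ x ≈ℚ ι (iterate (apply F) x k)
    composition-ι {zero}  D x h = ℚ.refl
    composition-ι {suc k} D x h = ℚ.trans
      -- Equality in `∣ A ∣` ignores membership proofs, so the intermediate value may be replaced by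
      -- `ιᴬ` of the iterate.
      (Func.cong (step A R closed (last D)) {y = ιᴬ (iterate (apply F) x k)}
        (composition-ι (init D) x h-init))
      (≡.subst (λ y → proj₁ (step A R closed (last D) ⟨$⟩ ιᴬ (iterate (apply F) x k)) ≈ℚ ι y)
        (≡.sym (iterate-suc (apply F) x k)) (step-ι (last D) _ h-last))
      where
      h-init : ∀ i → expansion F x (toℕ i) ≡ init D i
      h-init i = ≡.trans (≡.cong (expansion F x) (≡.sym (toℕ-inject₁ i))) (h (inject₁ i))

      h-last : expansion F x k ≡ last D
      h-last = ≡.trans (≡.cong (expansion F x) (≡.sym (toℕ-fromℕ k))) (h (fromℕ k))

    -- Integrality propagates backwards: an integral final value puts the preceding value `z` into
    -- the class of `last D`, so `z` is integral and the induction applies to `init D`. Then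
    -- `composition-ι` identifies `z` with the k-th iterate, whose digit is thus `last D`. The value
    -- `b` is arbitrary because intermediate values need not equal `x`.
    composition-ι⁻¹ : ∀ {k} (D : Vector (Fin p) k) x b →
      composition A R closed D ⟨$⟩ ιᴬ x ≈ℚ ι b →
      ∀ i → expansion F x (toℕ i) ≡ D i
    composition-ι⁻¹ {suc k} D x b eq = digits (step-ι⁻¹ (last D) z eq)
      where
      z : Setoid.Carrier ∣ A ∣
      z = compositionᴬ A R closed (init D) ⟨$⟩ ιᴬ x

      digits : ι[ last D +pℤₚ ] (proj₁ z) → ∀ i → expansion F x (toℕ i) ≡ D i
      digits (c , c∈ , z≈c) i = go (view i)
        where
        h-init : ∀ i → expansion F x (toℕ i) ≡ init D i
        h-init = composition-ι⁻¹ (init D) x c z≈c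

        c≈ : c ≈ₚ iterate (apply F) x k
        c≈ = ι-injective (ℚ.trans (ℚ.sym z≈c) (composition-ι (init D) x h-init))

        go : ∀ {i} → View i → expansion F x (toℕ i) ≡ D i
        go ‵fromℕ           = ≡.trans (≡.cong (expansion F x) (toℕ-fromℕ k))
          (+pℤₚ⇒%p (last D) (iterate (apply F) x k) (+pℤₚ-resp-≈ (last D) c≈ c∈))
        go (‵inj₁ {i = j} _) = ≡.trans (≡.cong (expansion F x) (toℕ-inject₁ j)) (h-init j)

    module _ {k} (D : Vector (Fin p) (suc k)) where
      private
        K : ℕ
        K = suc k

        D^∞ : ℕ → Fin p
        D^∞ i = D (i modℕ K)

      D^∞-toℕ : ∀ j → D^∞ (toℕ j) ≡ D j
      D^∞-toℕ j = ≡.cong D (toℕ-injective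
        (≡.trans (toℕ-fromℕ< (m%n<n (toℕ j) K)) (m<n⇒m%n≡m (toℕ<n j))))

      D^∞-periodic : ∀ i → D^∞ (K ℕ.+ i) ≡ D^∞ i
      D^∞-periodic i = ≡.cong D (fromℕ<-cong ((K ℕ.+ i) % K) (i % K)
        (≡.trans (≡.cong (_% K) (ℕ.+-comm K i)) ([m+n]%n≡m%n i K))
        (m%n<n (K ℕ.+ i) K) (m%n<n i K))

      -- The expansion of the K-th iterate is that of `x` shifted by `K`; periodicity makes the two
      -- equal, so the iterate is `x` itself.
      D^∞⇒fixed : ∀ {x} → (∀ i → expansion F x i ≡ D^∞ i) →
        composition A R closed D ⟨$⟩ ιᴬ x ≈ℚ ι x
      D^∞⇒fixed {x} h = ℚ.trans
        (composition-ι D x λ j → ≡.trans (h (toℕ j)) (D^∞-toℕ j))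
        (ι-cong (expansion-injective λ i →
          ≡.trans (≡.cong _%p (≡.sym (iterate-+ (apply F) x K i)))
            (≡.trans (h (K ℕ.+ i)) (≡.trans (D^∞-periodic i) (≡.sym (h i))))))

      -- A fixed point has an integral image, so its expansion starts with `D` and the image is the
      -- K-th iterate. That iterate being `x`, the expansion repeats with period `K`.
      fixed⇒D^∞ : ∀ {x} → composition A R closed D ⟨$⟩ ιᴬ x ≈ℚ ι x →
        ∀ i → expansion F x i ≡ D^∞ i
      fixed⇒D^∞ {x} fixed i = ≡.trans (periodic-% (expansion F x) K periodic i)
        (≡.trans (≡.cong (expansion F x) (≡.sym (toℕ-fromℕ< (m%n<n i K)))) (prefix (i modℕ K)))
        where
        prefix : ∀ j → expansion F x (toℕ j) ≡ D j
        prefix = composition-ι⁻¹ D x x fixed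

        F^K[x]≈x : iterate (apply F) x K ≈ₚ x
        F^K[x]≈x = ι-injective (ℚ.trans (ℚ.sym (composition-ι D x prefix)) fixed)

        periodic : ∀ i → expansion F x (K ℕ.+ i) ≡ expansion F x i
        periodic i = ≡.trans (≡.cong _%p (iterate-+ (apply F) x K i))
          (expansion-cong F^K[x]≈x i)

      fixedPoint : ∃! _≈ₚ_ (λ x → composition A R closed D ⟨$⟩ ιᴬ x ≈ℚ ι x)
      fixedPoint = limit D^∞ , D^∞⇒fixed (expansion-limit D^∞) , λ fixed →
        expansion-injective λ i →
          ≡.trans (expansion-limit D^∞ i) (≡.sym (fixed⇒D^∞ fixed i))

theorem5p11 : ∀ {ℓ : Level} (p : ℕ) .{{_ : NonTrivial p}} → let open Padic p in
    (A : Subset ℓ) (ℤₚ⊆A : Containsℤₚ A) (R : FibredRational A) →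
    (closed : Closed A R) → Avoiding A R →
    (integral : MapsℤₚToℤₚ A R ℤₚ⊆A) →
    IsPadicSystem (restriction A R ℤₚ⊆A integral) →
    WeakCanonicalForm (restriction A R ℤₚ⊆A integral) →
    ∀ k (D : Vector (Fin p) (suc k)) →
    ∃! _≈ₚ_ (λ x → composition A R closed D ⟨$⟩ (ι x , ℤₚ⊆A x) ≈ℚ ι x)
theorem5p11 p A ℤₚ⊆A R closed avoiding integral padic canonical k D =
  PadicProperties.Fixed.fixedPoint p A ℤₚ⊆A R closed avoiding integral padic canonical D
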